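{- Let $(G,s,t)$ be a minimal weak link of weight $w$, with terminal degrees $d_s,d_t$, and let $p$ be the number of centre vertices. Then: if $w>3$ then $p\ge 1$; if $w>5$ then $p\ge 2$; and if $w\le 7$ then $d_s+d_t\le \frac{w+3}{2}$.
   Context: A Shannon game (link) $(G,s,t)$ consists of a finite simple graph $G$ and two distinct designated vertices $s,t$, the terminals. Two players, Short and Cut, alternately select a not-yet-selected non-terminal vertex; Short claims his vertices, Cut deletes his. Short wins if at the end there is an $s$–$t$ path all of whose internal vertices are claimed by Short; otherwise Cut wins. The link is strong if Short has a winning strategy when moving second, and weak if Short has a winning strategy when moving first but not when moving second. A weak link is minimal if deleting any single edge of $G$ produces a game in which Short has no winning strategy as first player. The weight $w$ is the number of non-terminal vertices. The borders are $B_s=\Gamma(s)$ and $B_t=\Gamma(t)$ (neighbourhoods of the terminals); the centre is the set of vertices that are neither terminals nor in $B_s\cup B_t$, and $p$ denotes its size. -}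

module Defs where

open import Data.Nat using (ℕ; zero; suc; _+_)
open import Data.Fin using (Fin; _≟_)
open import Data.Bool using (Bool; true; false; if_then_else_; _∧_; _∨_; not)
open import Data.Product using (_×_; Σ)
open import Data.Sum using (_⊎_)
open import Relation.Nullary using (¬_; does)
open import Relation.Binary.PropositionalEquality using (_≡_; _≢_)

Adj : ℕ → Set
Adj n = Fin n → Fin n → Bool

record Graph (n : ℕ) : Set where
  field
    adj    : Adj n
    sym    : ∀ x y → adj x y ≡ adj y x
    irrefl : ∀ x → adj x x ≡ false
open Graph public

_==_ : ∀ {n} → Fin n → Fin n → Bool
x == y = does (x ≟ y)

deleteEdge : ∀ {n} → Adj n → Fin n → Fin n → Adj n
deleteEdge a u v x y = a x y ∧ not ((x == u ∧ y == v) ∨ (x == v ∧ y == u))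

data Mark : Set where
  free short cut : Mark

State : ℕ → Set
State n = Fin n → Mark

initial : ∀ {n} → State n
initial _ = free

_[_≔_] : ∀ {n} → State n → Fin n → Mark → State n
(σ [ v ≔ m ]) x = if x == v then m else σ x

module Game {n : ℕ} (a : Adj n) (s t : Fin n) where

  Free : State n → Fin n → Set
  Free σ v = (σ v ≡ free) × (v ≢ s) × (v ≢ t)

  NoFree : State n → Set
  NoFree σ = ∀ v → ¬ Free σ v

  data Reach (σ : State n) : Fin n → Set where
    start : Reach σ s
    step  : ∀ {u v} → Reach σ u → (u ≡ s ⊎ σ u ≡ short) →
            a u v ≡ true → Reach σ v

  ShortConnects : State n → Set
  ShortConnects σ = Reach σ t

  mutual
    data WinShortToMove (σ : State n) : Set where
      done : NoFree σ → ShortConnects σ → WinShortToMove σ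
      move : (v : Fin n) → Free σ v →
             WinCutToMove (σ [ v ≔ short ]) → WinShortToMove σ

    data WinCutToMove (σ : State n) : Set where
      done : NoFree σ → ShortConnects σ → WinCutToMove σ
      move : (Σ (Fin n) λ v → Free σ v) →
             (∀ v → Free σ v → WinShortToMove (σ [ v ≔ cut ])) →
             WinCutToMove σ

  ShortWinsFirst : Set
  ShortWinsFirst = WinShortToMove initial

  ShortWinsSecond : Set
  ShortWinsSecond = WinCutToMove initial

WeakLink : ∀ {n} → Graph n → Fin n → Fin n → Set
WeakLink G s t = Game.ShortWinsFirst (adj G) s t × ¬ Game.ShortWinsSecond (adj G) s t

MinimalWeakLink : ∀ {n} → Graph n → Fin n → Fin n → Set
MinimalWeakLink G s t =
  WeakLink G s t ×
  (∀ u v → adj G u v ≡ true →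
     ¬ Game.ShortWinsFirst (deleteEdge (adj G) u v) s t)

count : ∀ {n} → (Fin n → Bool) → ℕ
count {zero}  f = 0
count {suc n} f = (if f Fin.zero then 1 else 0) + count (λ i → f (Fin.suc i))

degree : ∀ {n} → Graph n → Fin n → ℕ
degree G x = count (adj G x)

isCentre : ∀ {n} → Graph n → Fin n → Fin n → Fin n → Bool
isCentre G s t v = not (v == s) ∧ not (v == t) ∧ not (adj G s v) ∧ not (adj G t v)

centreSize : ∀ {n} → Graph n → Fin n → Fin n → ℕ
centreSize G s t = count (isCentre G s t)

{-# OPTIONS --safe #-}
-- If every non-terminal lies in exactly one border, Short wins exactly when he
-- holds both ends of an edge joining the borders.  Were these edges a matching,
-- Cut would answer every claim by deleting the matched vertex; so some vertex has
-- two partners, and these three vertices already carry a win for Short.  With a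
-- single centre vertex c the same pairing works for Cut until Short takes c (or
-- until Short takes an unmatched vertex, whereupon Cut deletes c), unless one of
-- three configurations on c and four border vertices is present.  In each case
-- Short wins on at most five vertices, and by minimality every other vertex is
-- isolated from the terminals, hence central.  The degree bound for w ≤ 7 follows
-- from d_s + d_t + p ≤ w; if the borders meet, one vertex wins and d_s = d_t = 1.
module Submission where

open import Defs
open import Data.Nat using (ℕ; zero; suc; _+_; _*_; _∸_; _≤_; _<_; z≤n; s≤s; s≤s⁻¹)
open import Data.Nat.Properties
  using (≤-trans; ≤-antisym; <-≤-trans; ≤⇒≯; ≮⇒≥; n<1+n; n≤1+n; m≤n+m; _<?_;
         +-suc; +-comm; +-assoc; +-identityʳ; +-mono-≤; +-monoˡ-≤; +-monoʳ-≤; +-cancelʳ-≤;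
         *-distribˡ-+; *-monoʳ-≤; module ≤-Reasoning)
open import Data.Fin using (Fin; _≟_)
open import Data.Fin.Properties using (any?; injective⇒≤; ¬∀⟶∃¬)
open import Data.Bool using (Bool; true; false; _∧_; _∨_; not)
import Data.Bool.Properties as Bool
open import Data.List using (List; []; _∷_; length)
open import Data.List.Relation.Unary.Any using (here; there)
open import Data.List.Membership.DecPropositional using (_∈?_)
open import Data.List.Membership.Propositional using (_∈_; _∉_)
open import Data.List.Membership.Setoid.Properties using (index-injective)
open import Data.Product using (∃; ∃₂; _×_; _,_; proj₁; proj₂)
open import Data.Sum using (_⊎_; inj₁; inj₂; [_,_]′)
open import Data.Empty using (⊥; ⊥-elim)
open import Function using (_∘_; id)
open import Relation.Nullary using (¬_; Dec; yes; no; contradiction; does)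
open import Relation.Nullary.Decidable using (dec-true; dec-false; _×-dec_; _⊎-dec_; ¬?; map′; decidable-stable)
open import Relation.Binary.PropositionalEquality
  using (_≡_; _≢_; refl; trans; cong; cong₂; subst; ≢-sym; setoid) renaming (sym to ≡-sym)

private variable
  n : ℕ

-- Boolean equality and connectives.

==-refl : (x : Fin n) → (x == x) ≡ true
==-refl x = dec-true (x ≟ x) refl

==-true : {x y : Fin n} → (x == y) ≡ true → x ≡ y
==-true {x = x} {y} e with x ≟ y
... | yes x≡y = x≡y

==-false : {x y : Fin n} → x ≢ y → (x == y) ≡ false
==-false {x = x} {y} = dec-false (x ≟ y)

∨-false : ∀ {a b} → a ≡ false → b ≡ false → a ∨ b ≡ false
∨-false refl refl = refl

∨-true : ∀ a {b} → a ∨ b ≡ true → a ≡ true ⊎ b ≡ true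
∨-true true  _ = inj₁ refl
∨-true false e = inj₂ e

∧-true : ∀ a {b} → a ∧ b ≡ true → a ≡ true × b ≡ true
∧-true true e = refl , e

not-true : ∀ a → not a ≡ true → a ≡ false
not-true false _ = refl

false≢true : ∀ {a} → a ≡ false → a ≢ true
false≢true refl ()

-- Counting vertices.

count-mono : (f g : Fin n → Bool) → (∀ i → f i ≡ true → g i ≡ true) → count f ≤ count g
count-mono {zero}  f g f⊆g = z≤n
count-mono {suc n} f g f⊆g with f Fin.zero in ef | g Fin.zero in eg
... | false | false = count-mono _ _ (λ i → f⊆g (Fin.suc i))
... | false | true  = ≤-trans (count-mono _ _ (λ i → f⊆g (Fin.suc i))) (m≤n+m _ 1)
... | true  | true  = s≤s (count-mono _ _ (λ i → f⊆g (Fin.suc i)))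
... | true  | false = contradiction (f⊆g Fin.zero ef) (false≢true eg)

count-∨ : (f g : Fin n → Bool) → (∀ i → f i ≡ true → g i ≡ false) →
          count (λ i → f i ∨ g i) ≡ count f + count g
count-∨ {zero}  f g f#g = refl
count-∨ {suc n} f g f#g with f Fin.zero in ef | g Fin.zero in eg
... | false | false = count-∨ _ _ (λ i → f#g (Fin.suc i))
... | false | true  = trans (cong suc (count-∨ _ _ (λ i → f#g (Fin.suc i))))
                            (≡-sym (+-suc _ _))
... | true  | false = cong suc (count-∨ _ _ (λ i → f#g (Fin.suc i)))
... | true  | true  = contradiction eg (false≢true (f#g Fin.zero ef))

count-none : (f : Fin n → Bool) → (∀ i → f i ≡ false) → count f ≡ 0
count-none {zero}  f none = refl
count-none {suc n} f none rewrite none Fin.zero = count-none _ (none ∘ Fin.suc)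

count-== : (x : Fin n) → count (_== x) ≡ 1
count-== {suc n} Fin.zero = cong suc (count-none {n} (λ i → Fin.suc i == Fin.zero) (λ _ → refl))
count-== (Fin.suc x) = trans (≤-antisym (count-mono _ _ unshift) (count-mono _ _ shift)) (count-== x)
  where
  unshift : ∀ i → (Fin.suc i == Fin.suc x) ≡ true → (i == x) ≡ true
  unshift i e with refl ← ==-true {x = Fin.suc i} {Fin.suc x} e = ==-refl i
  shift : ∀ i → (i == x) ≡ true → (Fin.suc i == Fin.suc x) ≡ true
  shift i e with refl ← ==-true {x = i} {x} e = ==-refl (Fin.suc i)

count-≤ : (f : Fin n → Bool) → count f ≤ n
count-≤ {zero}  f = z≤n
count-≤ {suc n} f with f Fin.zero
... | true  = s≤s (count-≤ (f ∘ Fin.suc))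
... | false = ≤-trans (count-≤ (f ∘ Fin.suc)) (m≤n+m n 1)

count-insert : (f : Fin n → Bool) (x : Fin n) → f x ≡ false →
               count (λ i → (i == x) ∨ f i) ≡ suc (count f)
count-insert f x fx = trans (count-∨ (_== x) f fresh) (cong (_+ count f) (count-== x))
  where
  fresh : ∀ i → (i == x) ≡ true → f i ≡ false
  fresh i e with refl ← ==-true {x = i} {x} e = fx

count-strict : (f g : Fin n → Bool) (x : Fin n) → (∀ i → f i ≡ true → g i ≡ true) →
               f x ≡ false → g x ≡ true → count f < count g
count-strict f g x f⊆g fx gx =
  subst (_≤ count g) (count-insert f x fx) (count-mono _ g incl)
  where
  incl : ∀ i → (i == x) ∨ f i ≡ true → g i ≡ true
  incl i e with ∨-true (i == x) e
  ... | inj₂ fi = f⊆g i fi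
  ... | inj₁ e′ with refl ← ==-true {x = i} {x} e′ = gx

count≤1⇒unique : (x : Fin n) (g : Fin n → Bool) → count g ≤ 1 →
                 g x ≡ true → ∀ {y} → g y ≡ true → x ≡ y
count≤1⇒unique x g g≤1 gx {y} gy with x ≟ y
... | yes x≡y = x≡y
... | no  x≢y = contradiction
  (subst (_< count g) (count-== x) (count-strict (_== x) g y incl (==-false (≢-sym x≢y)) gy)) (≤⇒≯ g≤1)
  where
  incl : ∀ i → (i == x) ≡ true → g i ≡ true
  incl i e with refl ← ==-true {x = i} {x} e = gx

count-pos : (f : Fin n → Bool) {x : Fin n} → f x ≡ true → 1 ≤ count f
count-pos {n} f {x} fx =
  subst (_< count f) (count-none {n} (λ _ → false) (λ _ → refl))
        (count-strict (λ _ → false) f x (λ _ ()) refl fx)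

-- Otherwise sending each vertex to its position in the list would inject `Fin n` into a set of size
-- `length xs`.
∃-outside : (xs : List (Fin n)) → length xs < n → ∃ λ z → z ∉ xs
∃-outside {n} xs len = ¬∀⟶∃¬ n (_∈ xs) (λ z → _∈?_ _≟_ z xs) λ all →
  ≤⇒≯ (injective⇒≤ (λ {x} {y} → index-injective (setoid (Fin n)) (all x) (all y))) len

∉-head : {x z : Fin n} {xs : List (Fin n)} → z ∉ x ∷ xs → x ≢ z
∉-head z∉ refl = z∉ (here refl)

∉-tail : {x z : Fin n} {xs : List (Fin n)} → z ∉ x ∷ xs → z ∉ xs
∉-tail z∉ = z∉ ∘ there

-- Marks and positions.

free? : (m : Mark) → Dec (m ≡ free)
free? free  = yes refl
free? short = no λ ()
free? cut   = no λ ()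

short? : (m : Mark) → Dec (m ≡ short)
short? free  = no λ ()
short? short = yes refl
short? cut   = no λ ()

cut? : (m : Mark) → Dec (m ≡ cut)
cut? free  = no λ ()
cut? short = no λ ()
cut? cut   = yes refl

set-same : (σ : State n) (v : Fin n) (m : Mark) → (σ [ v ≔ m ]) v ≡ m
set-same σ v m rewrite ==-refl v = refl

set-other : (σ : State n) {v x : Fin n} {m : Mark} → x ≢ v → (σ [ v ≔ m ]) x ≡ σ x
set-other σ x≢v rewrite ==-false x≢v = refl

infix 4 _⊑_
-- Only claimed vertices are compared, because `Reach` depends on the position through them alone.
record _⊑_ (σ τ : State n) : Set where
  constructor extends
  field retain : ∀ {x} → σ x ≡ short → τ x ≡ short
open _⊑_

⊑-trans : {σ τ υ : State n} → σ ⊑ τ → τ ⊑ υ → σ ⊑ υ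
⊑-trans σ⊑τ τ⊑υ = extends (retain τ⊑υ ∘ retain σ⊑τ)

-- Winning strategies for Short.

module Strategy (a : Adj n) (s t : Fin n) where
  open Game a s t

  taken≢free : ∀ {σ v x m} → Free σ v → σ x ≡ m → m ≢ free → x ≢ v
  taken≢free (fv , _) σx m≢ refl = m≢ (trans (≡-sym σx) fv)

  stay-short : ∀ σ {v x m} → Free σ v → σ x ≡ short → (σ [ v ≔ m ]) x ≡ short
  stay-short σ fv σx = trans (set-other σ (taken≢free {σ} fv σx λ ())) σx

  mark-⊑ : ∀ {σ v m} → Free σ v → σ ⊑ (σ [ v ≔ m ])
  mark-⊑ {σ} fv = extends (stay-short σ fv)

  stay-cut : ∀ σ {v x m} → Free σ v → σ x ≡ cut → (σ [ v ≔ m ]) x ≡ cut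
  stay-cut σ fv σx = trans (set-other σ (taken≢free {σ} fv σx λ ())) σx

  stay-free : ∀ σ {v x m} → x ≢ v → Free σ x → Free (σ [ v ≔ m ]) x
  stay-free σ x≢v (fx , nt) = trans (set-other σ x≢v) fx , nt

  Reach-mono : ∀ {σ τ x} → σ ⊑ τ → Reach σ x → Reach τ x
  Reach-mono σ⊑τ start                = start
  Reach-mono σ⊑τ (step r (inj₁ e) av) = step (Reach-mono σ⊑τ r) (inj₁ e) av
  Reach-mono σ⊑τ (step r (inj₂ e) av) = step (Reach-mono σ⊑τ r) (inj₂ (retain σ⊑τ e)) av

  Free? : ∀ σ v → Dec (Free σ v)
  Free? σ v = free? (σ v) ×-dec ¬? (v ≟ s) ×-dec ¬? (v ≟ t)

  -- Terminals marked `free` are counted as well; all that matters is that every move lowers this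
  -- number.
  remaining : State n → ℕ
  remaining σ = count (λ v → does (free? (σ v)))

  remaining-< : ∀ σ {v} m → Free σ v → m ≢ free → remaining (σ [ v ≔ m ]) < remaining σ
  remaining-< σ {v} m (fv , _) m≢ = count-strict _ _ v incl
      (dec-false (free? _) (m≢ ∘ trans (≡-sym (set-same σ v m)))) (dec-true (free? _) fv)
    where
    incl : ∀ i → does (free? ((σ [ v ≔ m ]) i)) ≡ true → does (free? (σ i)) ≡ true
    incl i e with i ≟ v
    ... | yes refl = dec-true (free? (σ i)) fv
    ... | no _     = e

  -- Claims are never undone, so an existing connection survives arbitrary play to the end. The
  -- induction is on the number of free marks, bounded by `k`, and treats both turns together
  -- because each move leads to the other.
  connected-wins : ∀ k σ → remaining σ < k → Reach σ t → WinShortToMove σ × WinCutToMove σ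
  connected-wins (suc k) σ bound r with any? (Free? σ)
  ... | no  nf       = done (λ v fv → nf (v , fv)) r , done (λ v fv → nf (v , fv)) r
  ... | yes (v , fv) =
    move v fv (proj₂ (after fv (λ ()))) , move (v , fv) (λ u fu → proj₁ (after fu (λ ())))
    where
    after : ∀ {u m} → Free σ u → m ≢ free →
            WinShortToMove (σ [ u ≔ m ]) × WinCutToMove (σ [ u ≔ m ])
    after {m = m} fu m≢ = connected-wins k _ (<-≤-trans (remaining-< σ m fu m≢) (s≤s⁻¹ bound))
                            (Reach-mono (mark-⊑ fu) r)

  connected-second : ∀ {σ} → Reach σ t → WinCutToMove σ
  connected-second r = proj₂ (connected-wins _ _ (n<1+n _) r)

  -- A threat: with `x` claimed, `y` completes a connection. Quantifying over all extensions of `σ`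
  -- makes a threat persist through later moves.
  Line : State n → Fin n → Fin n → Set
  Line σ x y = ∀ {τ} → σ ⊑ τ → τ x ≡ short → τ y ≡ short → Reach τ t

  Line-mono : ∀ {σ τ x y} → σ ⊑ τ → Line σ x y → Line τ x y
  Line-mono σ⊑τ l τ⊑υ = l (⊑-trans σ⊑τ τ⊑υ)

  finish : ∀ σ {x y} → σ x ≡ short → Free σ y → Line σ x y → WinShortToMove σ
  finish σ {x} {y} σx fy l =
    move y fy (connected-second (l (mark-⊑ fy) (stay-short σ fy σx) (set-same σ y short)))

  -- If Cut deletes anything but `y`, Short claims `y` and is connected. Hence only the reply `y`
  -- has to be analysed.
  force : ∀ σ {x y} → Free σ x → Free σ y → x ≢ y → Line σ x y →
          WinShortToMove ((σ [ x ≔ short ]) [ y ≔ cut ]) → WinShortToMove σ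
  force σ {x} {y} fx fy x≢y l w = move x fx (move (y , stay-free σ (≢-sym x≢y) fy) answer)
    where
    answer : ∀ v → Free (σ [ x ≔ short ]) v → WinShortToMove ((σ [ x ≔ short ]) [ v ≔ cut ])
    answer v fv with y ≟ v
    ... | yes refl = w
    ... | no y≢v = finish _ (stay-short (σ [ x ≔ short ]) fv (set-same σ x short))
                     (stay-free (σ [ x ≔ short ]) y≢v (stay-free σ (≢-sym x≢y) fy))
                     (Line-mono (⊑-trans (mark-⊑ fx) (mark-⊑ fv)) l)

  -- A double threat: the deletion of `y` is forced, and `z` then finishes.
  fork : ∀ σ {x y z} → Free σ x → Free σ y → Free σ z → x ≢ y → x ≢ z → y ≢ z →
         Line σ x y → Line σ x z → WinShortToMove σ
  fork σ {x} {y} {z} fx fy fz x≢y x≢z y≢z ly lz = force σ fx fy x≢y ly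
    (finish _ (stay-short (σ [ x ≔ short ]) fy′ (set-same σ x short))
      (stay-free (σ [ x ≔ short ]) (≢-sym y≢z) (stay-free σ (≢-sym x≢z) fz))
      (Line-mono (⊑-trans (mark-⊑ fx) (mark-⊑ fy′)) lz))
    where
    fy′ : Free (σ [ x ≔ short ]) y
    fy′ = stay-free σ (≢-sym x≢y) fy

  Inner : Fin n → Set
  Inner v = v ≢ s × v ≢ t

  Path₁ : Fin n → Set
  Path₁ x = ∀ {τ} → τ x ≡ short → Reach τ t

  Path₂ : Fin n → Fin n → Set
  Path₂ x y = ∀ {τ} → τ x ≡ short → τ y ≡ short → Reach τ t

  Path₃ : Fin n → Fin n → Fin n → Set
  Path₃ x c y = ∀ {τ} → τ x ≡ short → τ c ≡ short → τ y ≡ short → Reach τ t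

  singleton-wins : ∀ {x} → Inner x → Path₁ x → ShortWinsFirst
  singleton-wins {x} ix p = move x (refl , ix) (connected-second (p (set-same initial x short)))

  cherry-wins : ∀ {x y z} → Inner x → Inner y → Inner z → x ≢ y → x ≢ z → y ≢ z →
                Path₂ x y → Path₂ x z → ShortWinsFirst
  cherry-wins ix iy iz x≢y x≢z y≢z p q =
    fork initial (refl , ix) (refl , iy) (refl , iz) x≢y x≢z y≢z (λ _ → p) (λ _ → q)

  -- Once `c` is claimed, each of `x`, `y` together with each of `z`, `w` completes a path, so the
  -- threats form a 4-cycle. Any single deletion leaves a vertex of this cycle with both of its
  -- neighbours, which is a fork.
  hub-wins : ∀ {c x y z w} → Inner c → Inner x → Inner y → Inner z → Inner w →
             c ≢ x → c ≢ y → c ≢ z → c ≢ w → x ≢ y → z ≢ w → x ≢ z → x ≢ w → y ≢ z → y ≢ w →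
             Path₃ x c z → Path₃ x c w → Path₃ y c z → Path₃ y c w → ShortWinsFirst
  hub-wins {c} {x} {y} {z} {w} ic ix iy iz iw c≢x c≢y c≢z c≢w x≢y z≢w x≢z x≢w y≢z y≢w xz xw yz yw =
    move c (refl , ic) (move (x , keep ix c≢x) answer)
    where
    σ : State _
    σ = initial [ c ≔ short ]

    keep : ∀ {v} → Inner v → c ≢ v → Free σ v
    keep iv c≢v = stay-free initial (≢-sym c≢v) (refl , iv)

    prong : ∀ {v p q} → Free σ v → Path₃ p c q → Line (σ [ v ≔ cut ]) p q
    prong fv p e τp = p τp (retain (⊑-trans (mark-⊑ fv) e) (set-same initial c short))

    flip₃ : ∀ {p q} → Path₃ p c q → Path₃ q c p
    flip₃ p τq τc τp = p τp τc τq

    branch : ∀ {p q r v} → Free σ v → Inner p → Inner q → Inner r → c ≢ p → c ≢ q → c ≢ r →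
             p ≢ v → q ≢ v → r ≢ v → p ≢ q → p ≢ r → q ≢ r → Path₃ p c q → Path₃ p c r →
             WinShortToMove (σ [ v ≔ cut ])
    branch fv ip iq ir c≢p c≢q c≢r p≢v q≢v r≢v p≢q p≢r q≢r pq pr =
      fork _ (stay-free σ p≢v (keep ip c≢p)) (stay-free σ q≢v (keep iq c≢q))
        (stay-free σ r≢v (keep ir c≢r)) p≢q p≢r q≢r (prong fv pq) (prong fv pr)

    answer : ∀ v → Free σ v → WinShortToMove (σ [ v ≔ cut ])
    answer v fv with z ≟ v | w ≟ v | x ≟ v
    ... | yes refl | _ | _ = branch fv iw ix iy c≢w c≢x c≢y (≢-sym z≢w) x≢z y≢z
                               (≢-sym x≢w) (≢-sym y≢w) x≢y (flip₃ xw) (flip₃ yw)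
    ... | no z≢v | yes refl | _ = branch fv iz ix iy c≢z c≢x c≢y z≢v x≢w y≢w
                               (≢-sym x≢z) (≢-sym y≢z) x≢y (flip₃ xz) (flip₃ yz)
    ... | no z≢v | no w≢v | yes refl = branch fv iy iz iw c≢y c≢z c≢w (≢-sym x≢y) z≢v w≢v
                               y≢z y≢w z≢w yz yw
    ... | no z≢v | no w≢v | no x≢v = branch fv ix iz iw c≢x c≢z c≢w x≢v z≢v w≢v
                               x≢z x≢w z≢w xz xw

  -- Claiming `x` forces the deletion of `x′`, so Short keeps the move and gains `x`, which may take
  -- part in the two threats from `y`.
  forced-fork-wins : ∀ {x x′ y z w} → Inner x → Inner x′ → Inner y → Inner z → Inner w →
                     x ≢ x′ → x ≢ y → x ≢ z → x ≢ w → x′ ≢ y → x′ ≢ z → x′ ≢ w → y ≢ z → y ≢ w → z ≢ w →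
                     Path₂ x x′ → Line (initial [ x ≔ short ]) y z → Line (initial [ x ≔ short ]) y w →
                     ShortWinsFirst
  forced-fork-wins {x} {x′} ix ix′ iy iz iw x≢x′ x≢y x≢z x≢w x′≢y x′≢z x′≢w y≢z y≢w z≢w p lz lw =
    force initial (refl , ix) (refl , ix′) x≢x′ (λ _ → p)
      (fork _ (keep iy x≢y x′≢y) (keep iz x≢z x′≢z) (keep iw x≢w x′≢w) y≢z y≢w z≢w
        (Line-mono (mark-⊑ fx′) lz) (Line-mono (mark-⊑ fx′) lw))
    where
    fx′ : Free (initial [ x ≔ short ]) x′
    fx′ = stay-free initial (≢-sym x≢x′) (refl , ix′)
    keep : ∀ {v} → Inner v → x ≢ v → x′ ≢ v → Free ((initial [ x ≔ short ]) [ x′ ≔ cut ]) v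
    keep iv x≢v x′≢v =
      stay-free (initial [ x ≔ short ]) (≢-sym x′≢v) (stay-free initial (≢-sym x≢v) (refl , iv))

-- Borders, centre, and edges between the borders.

module Link (G : Graph n) (s t : Fin n) where
  open Strategy using (Inner; Path₁; Path₂; Path₃)

  infix 4 _~_
  _~_ : Fin n → Fin n → Set
  x ~ y = adj G x y ≡ true

  _~?_ : ∀ x y → Dec (x ~ y)
  x ~? y = adj G x y Bool.≟ true

  ~-sym : ∀ {x y} → x ~ y → y ~ x
  ~-sym {x} {y} = trans (Graph.sym G y x)

  ~-irrefl : ∀ {x y} → x ~ y → x ≢ y
  ~-irrefl {x} xy refl = false≢true (irrefl G x) xy

  -- Wrapped in a record so that `v` can be read off from a proof; the Boolean equation itself
  -- unfolds.
  record Centre (v : Fin n) : Set where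
    constructor centre
    field isCentre-true : isCentre G s t v ≡ true
  open Centre

  Centre? : ∀ v → Dec (Centre v)
  Centre? v = map′ centre isCentre-true (isCentre G s t v Bool.≟ true)

  -- The terminals in either order, so that one argument serves both sides.
  data Opposite : Fin n → Fin n → Set where
    forth : Opposite s t
    back  : Opposite t s

  swap : ∀ {r q} → Opposite r q → Opposite q r
  swap forth = back
  swap back  = forth

  -- An edge joining the two borders. Either end may lie on the side of `s`, which makes the
  -- relation symmetric.
  Rung : Fin n → Fin n → Set
  Rung x y = x ~ y × ((s ~ x × t ~ y) ⊎ (t ~ x × s ~ y))

  Rung? : ∀ x y → Dec (Rung x y)
  Rung? x y = x ~? y ×-dec ((s ~? x ×-dec t ~? y) ⊎-dec (t ~? x ×-dec s ~? y))

  Rung-sym : ∀ {x y} → Rung x y → Rung y x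
  Rung-sym (xy , inj₁ (sx , ty)) = ~-sym xy , inj₂ (ty , sx)
  Rung-sym (xy , inj₂ (tx , sy)) = ~-sym xy , inj₁ (sy , tx)

  data Kind (v : Fin n) : Set where
    is-s   : v ≡ s → Kind v
    is-t   : v ≡ t → Kind v
    near-s : s ~ v → Kind v
    near-t : t ~ v → Kind v
    central : Centre v → Kind v

  kind : ∀ v → Kind v
  kind v with v ≟ s | v ≟ t | adj G s v in sv | adj G t v in tv
  ... | yes v≡s | _ | _ | _ = is-s v≡s
  ... | no _ | yes v≡t | _ | _ = is-t v≡t
  ... | no _ | no _ | true | _ = near-s sv
  ... | no _ | no _ | false | true = near-t tv
  ... | no v≢s | no v≢t | false | false = central (centre
    (cong₂ _∧_ (cong not (==-false v≢s)) (cong₂ _∧_ (cong not (==-false v≢t))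
      (cong₂ _∧_ (cong not sv) (cong not tv)))))

  centre-apart : ∀ {v} → Centre v → Inner (adj G) s t v × adj G s v ≡ false × adj G t v ≡ false
  centre-apart {v} (centre e) with ∧-true (not (v == s)) e
  ... | e₁ , e′ with ∧-true (not (v == t)) e′
  ... | e₂ , e″ with ∧-true (not (adj G s v)) e″
  ... | e₃ , e₄ = ((λ { refl → false≢true (not-true _ e₁) (==-refl s) }) ,
                   (λ { refl → false≢true (not-true _ e₂) (==-refl t) })) ,
                  not-true _ e₃ , not-true _ e₄

  -- Disjoint borders.

  module Separated
    (s≁t : adj G s t ≡ false)
    (disjoint : ∀ {v} → s ~ v → t ~ v → ⊥) where

    border-inner : ∀ {r q x} → Opposite r q → r ~ x → Inner (adj G) s t x
    border-inner forth sx = (≢-sym (~-irrefl sx)) , λ { refl → false≢true s≁t sx }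
    border-inner back tx = (λ { refl → false≢true s≁t (~-sym tx) }) , ≢-sym (~-irrefl tx)

    border-centre : ∀ {r q x c} → Opposite r q → r ~ x → Centre c → x ≢ c
    border-centre forth sx ce refl = false≢true (proj₁ (proj₂ (centre-apart ce))) sx
    border-centre back  tx ce refl = false≢true (proj₂ (proj₂ (centre-apart ce))) tx

    across : ∀ {r q x y} → Opposite r q → r ~ x → q ~ y → x ≢ y
    across forth sx ty refl = disjoint sx ty
    across back  tx sy refl = disjoint sy tx

    rung-side : ∀ {x y} → Rung x y → ∃₂ λ r q → Opposite r q × r ~ x × q ~ y
    rung-side (_ , inj₁ (sx , ty)) = s , t , forth , sx , ty
    rung-side (_ , inj₂ (tx , sy)) = t , s , back , tx , sy

    rung-inner : ∀ {x y} → Rung x y → Inner (adj G) s t x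
    rung-inner ρ with _ , _ , o , rx , _ ← rung-side ρ = border-inner o rx

    rung-centre : ∀ {x y c} → Rung x y → Centre c → x ≢ c
    rung-centre ρ with _ , _ , o , rx , _ ← rung-side ρ = border-centre o rx

    rung-across : ∀ {r q x y} → Opposite r q → r ~ x → Rung x y → q ~ y
    rung-across forth sx (_ , inj₁ (_ , ty)) = ty
    rung-across forth sx (_ , inj₂ (tx , _)) = ⊥-elim (disjoint sx tx)
    rung-across back  tx (_ , inj₁ (sx , _)) = ⊥-elim (disjoint sx tx)
    rung-across back  tx (_ , inj₂ (_ , sy)) = sy

    -- Cut's pairing strategy when the rungs form a matching.

    module Cut
      (matching : ∀ {x y z} → Rung x y → Rung x z → y ≡ z)
      (centre-unique : ∀ x y → Centre x → Centre y → x ≡ y) where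

      open Game (adj G) s t
      open Strategy (adj G) s t using (stay-cut; stay-free; taken≢free)

      -- The state of a rung whenever Short is to move: one end is deleted, or both are untouched.
      -- In particular Short never holds both ends.
      PairedAt : State n → Fin n → Fin n → Set
      PairedAt σ x y = σ x ≡ cut ⊎ σ y ≡ cut ⊎ (σ x ≡ free × σ y ≡ free)

      Paired : State n → Set
      Paired σ = ∀ {x y} → Rung x y → PairedAt σ x y

      -- No route from border to border through a centre vertex is still open.
      Dead : State n → Set
      Dead σ = ∀ {a c b} → s ~ a → a ~ c → Centre c → c ~ b → t ~ b →
               σ a ≡ cut ⊎ σ c ≡ cut ⊎ σ b ≡ cut

      Blocked : State n → Set
      Blocked σ = Paired σ × Dead σ

      dead-mark : ∀ σ {v m} → Free σ v → Dead σ → Dead (σ [ v ≔ m ])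
      dead-mark σ fv dead sa ac ce cb tb with dead sa ac ce cb tb
      ... | inj₁ e        = inj₁ (stay-cut σ fv e)
      ... | inj₂ (inj₁ e) = inj₂ (inj₁ (stay-cut σ fv e))
      ... | inj₂ (inj₂ e) = inj₂ (inj₂ (stay-cut σ fv e))

      paired-other : ∀ σ v m x y → x ≢ v → y ≢ v → PairedAt σ x y → PairedAt (σ [ v ≔ m ]) x y
      paired-other σ v m x y x≢v y≢v
        rewrite set-other σ {m = m} x≢v | set-other σ {m = m} y≢v = id

      paired-cut : ∀ σ v → Paired σ → Paired (σ [ v ≔ cut ])
      paired-cut σ v paired {x} {y} ρ with x ≟ v | y ≟ v
      ... | yes refl | _ = inj₁ refl
      ... | no _ | yes refl = inj₂ (inj₁ refl)
      ... | no x≢v | no y≢v = paired ρ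

      -- Since rungs form a matching, every rung other than that joining `v` and `u` avoids both
      -- vertices and keeps its state.
      paired-reply : ∀ σ {v u} → Rung v u → Paired σ → Paired ((σ [ v ≔ short ]) [ u ≔ cut ])
      paired-reply σ {v} {u} ρ paired {x} {y} ρ′ with x ≟ u | y ≟ u
      ... | yes refl | _ = inj₁ refl
      ... | no _ | yes refl = inj₂ (inj₁ refl)
      ... | no x≢u | no y≢u = paired-other σ v short x y
        (λ { refl → y≢u (matching ρ′ ρ) }) (λ { refl → x≢u (matching (Rung-sym ρ′) ρ) }) (paired ρ′)

      -- As `v` is free and has no free partner, the pairing leaves only the possibility that a
      -- partner of `v` is deleted. Its rung is therefore already harmless.
      paired-short : ∀ σ {v} → Free σ v → ¬ (∃ λ u → Rung v u × σ u ≡ free) →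
                     Paired σ → Paired (σ [ v ≔ short ])
      paired-short σ {v} fv none paired {x} {y} ρ = go (x ≟ v) (y ≟ v)
        where
        partner-cut : ∀ {y} → Rung v y → σ y ≡ cut
        partner-cut ρ′ with paired ρ′
        ... | inj₁ vc = contradiction refl (taken≢free {σ = σ} fv vc λ ())
        ... | inj₂ (inj₁ yc) = yc
        ... | inj₂ (inj₂ (_ , yf)) = contradiction (_ , ρ′ , yf) none
        go : Dec (x ≡ v) → Dec (y ≡ v) →
             PairedAt (σ [ v ≔ short ]) x y
        go (yes refl) _ = inj₂ (inj₁ (stay-cut σ fv (partner-cut ρ)))
        go (no _) (yes refl) = inj₁ (stay-cut σ fv (partner-cut (Rung-sym ρ)))
        go (no x≢v) (no y≢v) = paired-other σ v short x y x≢v y≢v (paired ρ)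

      -- An invariant for the vertices reachable from `s` in a blocked position. Crossing to the
      -- border of `t` is allowed only onto unclaimed vertices, from which no further step is
      -- possible.
      data Reached (σ : State n) (v : Fin n) : Set where
        at-s      : v ≡ s → Reached σ v
        at-near-s : s ~ v → Reached σ v
        at-centre : ∀ {a} → Centre v → s ~ a → a ~ v → σ a ≡ short → Reached σ v
        at-near-t : t ~ v → σ v ≢ short → Reached σ v

      cut≢short : ∀ {m} → m ≡ cut → m ≢ short
      cut≢short refl ()

      -- The two ways into the border of `t` are along a rung, where `Paired` keeps one end
      -- unclaimed, and through the centre, where `Dead` supplies a deleted vertex.
      reached-step : ∀ {σ u v} → Blocked σ → Reached σ u → σ u ≡ short → u ~ v → Reached σ v
      reached-step _ (at-s refl) _ uv = at-near-s uv
      reached-step _ (at-near-t _ ¬us) us _ = contradiction us ¬us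
      reached-step {v = v} (paired , dead) (at-near-s su) us uv with kind v
      ... | is-s e     = at-s e
      ... | is-t refl  = ⊥-elim (disjoint su (~-sym uv))
      ... | near-s sv  = at-near-s sv
      ... | central ce = at-centre ce su uv us
      ... | near-t tv with paired (uv , inj₁ (su , tv))
      ...   | inj₁ uc              = contradiction us (cut≢short uc)
      ...   | inj₂ (inj₁ vc)       = at-near-t tv (cut≢short vc)
      ...   | inj₂ (inj₂ (_ , vf)) = at-near-t tv λ vs → free≢short (trans (≡-sym vf) vs)
        where
        free≢short : free ≢ short
        free≢short ()
      reached-step {v = v} (paired , dead) (at-centre ce sa au as) us uv with kind v
      ... | is-s e      = at-s e
      ... | is-t refl   = contradiction (~-sym uv) (false≢true (proj₂ (proj₂ (centre-apart ce))))
      ... | near-s sv   = at-near-s sv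
      -- With only one centre vertex, no edge runs inside the centre.
      ... | central ce′ = contradiction (centre-unique _ _ ce ce′) (~-irrefl uv)
      ... | near-t tv with dead sa au ce uv tv
      ...   | inj₁ ac        = contradiction as (cut≢short ac)
      ...   | inj₂ (inj₁ uc) = contradiction us (cut≢short uc)
      ...   | inj₂ (inj₂ vc) = at-near-t tv (cut≢short vc)

      reached : ∀ {σ v} → Blocked σ → Reach σ v → Reached σ v
      reached _ start = at-s refl
      reached _ (step r (inj₁ refl) uv) = at-near-s uv
      reached blocked (step r (inj₂ us) uv) = reached-step blocked (reached blocked r) us uv

      disconnected : s ≢ t → ∀ {σ} → Blocked σ → ¬ ShortConnects σ
      disconnected s≢t blocked r with reached blocked r
      ... | at-s t≡s         = s≢t (≡-sym t≡s)
      ... | at-near-s st     = false≢true s≁t st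
      ... | at-centre ce _ _ _ = proj₂ (proj₁ (centre-apart ce)) refl
      ... | at-near-t tt _   = ~-irrefl tt refl

      module _ (s≢t : s ≢ t) where
        mutual
          -- Cut deletes the free partner of the vertex just claimed if there is one, and otherwise
          -- has a move to spare. The recursion descends through Short's supposed winning strategy.
          blocked-loses : ∀ {σ} → Blocked σ → ¬ WinShortToMove σ
          blocked-loses blocked (done _ r) = disconnected s≢t blocked r
          blocked-loses {σ} (paired , dead) (move v fv win)
            with any? (λ u → Rung? v u ×-dec free? (σ u))
          ... | no none = blocked-passes (paired-short σ fv none paired , dead-mark σ fv dead) win
          ... | yes (u , ρ , uf) =
            replies fu (paired-reply σ ρ paired , dead-mark (σ [ v ≔ short ]) fu (dead-mark σ fv dead)) win
            where
            fu : Free (σ [ v ≔ short ]) u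
            fu = stay-free σ (≢-sym (~-irrefl (proj₁ ρ))) (uf , rung-inner (Rung-sym ρ))

          -- A deletion never hurts Cut, so any free vertex will do; Short's strategy itself
          -- supplies one.
          blocked-passes : ∀ {σ} → Blocked σ → ¬ WinCutToMove σ
          blocked-passes blocked (done _ r) = disconnected s≢t blocked r
          blocked-passes {σ} (paired , dead) (move (v , fv) f) =
            blocked-loses (paired-cut σ v paired , dead-mark σ fv dead) (f v fv)

          replies : ∀ {σ u} → Free σ u → Blocked (σ [ u ≔ cut ]) → ¬ WinCutToMove σ
          replies fu _ (done nf _) = nf _ fu
          replies fu blocked (move _ f) = blocked-loses blocked (f _ fu)

        -- Cut's strategy around a single centre vertex.

        module Hub (c : Fin n) (central-c : Centre c)
          -- The excluded configurations are: two neighbours of `c` in each border; a rung at a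
          -- neighbour of `c`, with two further neighbours of `c` in the opposite border; two
          -- neighbours of `c` in opposite borders that lie on different rungs.
          (no-hub : ∀ {x y z w} → s ~ x → x ~ c → s ~ y → y ~ c → t ~ z → z ~ c → t ~ w → w ~ c →
                    x ≢ y → z ≢ w → ⊥)
          (no-rung-fork : ∀ {r q a a′ b b′} → Opposite r q → r ~ a → a ~ c → Rung a a′ →
                    q ~ b → b ~ c → q ~ b′ → b′ ~ c → b ≢ a′ → b′ ≢ a′ → b ≢ b′ → ⊥)
          (no-rung-pair : ∀ {r q a a′ b b′} → Opposite r q → r ~ a → a ~ c → Rung a a′ →
                    q ~ b → b ~ c → Rung b b′ → b ≢ a′ → ⊥) where

          -- The invariant of Cut's play before c is taken: each vertex claimed so far
          -- was answered by deleting its partner.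
          Waiting : State n → Set
          Waiting σ = σ c ≡ free × Paired σ × (∀ {x} → σ x ≡ short → ∃ λ y → Rung x y × σ y ≡ cut)

          Side : Fin n → Fin n → Set
          Side r x = r ~ x × x ~ c

          Side? : ∀ r x → Dec (Side r x)
          Side? r x = r ~? x ×-dec x ~? c

          Hits : State n → Fin n → Fin n → Fin n → Set
          Hits σ u a b = σ a ≡ cut ⊎ σ b ≡ cut ⊎ u ≡ a ⊎ u ≡ b

          -- What Cut needs once Short claims c: a vertex meeting every pair of live
          -- neighbours of c in the two borders, unless there is no such pair left.
          Answer : State n → Fin n → Fin n → Set
          Answer σ r q =
            (∀ {a b} → Side r a → Side q b → σ a ≡ cut ⊎ σ b ≡ cut) ⊎
            (∃ λ u → Free σ u × u ≢ c × (∀ {a b} → Side r a → Side q b → Hits σ u a b))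

          answer-swap : ∀ {σ r q} → Answer σ q r → Answer σ r q
          answer-swap (inj₁ d) = inj₁ λ sa sb → [ inj₂ , inj₁ ]′ (d sb sa)
          answer-swap (inj₂ (u , fu , u≢c , h)) = inj₂ (u , fu , u≢c , λ sa sb → turn (h sb sa))
            where
            turn : ∀ {σ u a b} → Hits σ u b a → Hits σ u a b
            turn (inj₁ e)               = inj₂ (inj₁ e)
            turn (inj₂ (inj₁ e))        = inj₁ e
            turn (inj₂ (inj₂ (inj₁ e))) = inj₂ (inj₂ (inj₂ e))
            turn (inj₂ (inj₂ (inj₂ e))) = inj₂ (inj₂ (inj₁ e))

          not-cut : ∀ {m} → m ≢ cut → m ≢ short → m ≡ free
          not-cut {free}  _ _ = refl
          not-cut {short} _ h = contradiction refl h
          not-cut {cut}   h _ = contradiction refl h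

          -- The partner `a′` of the claimed vertex is already deleted. By `no-rung-fork`, apart
          -- from `a′` the opposite border contains at most one neighbour `b` of `c`, so deleting
          -- `b` closes every route through `c`.
          answer-claimed : ∀ {σ r q a} → Opposite r q → Waiting σ → Side r a → σ a ≡ short → Answer σ r q
          answer-claimed {σ} {r} {q} {a} o (_ , _ , matched) (ra , ac) as
            with matched as | any? (λ b → Side? q b ×-dec ¬? (cut? (σ b)))
          ... | _ | no none = inj₁ λ {_} {b} _ sb →
                  inj₂ (decidable-stable (cut? (σ b)) λ b≢ → none (b , sb , b≢))
          ... | a′ , ρ , a′c | yes (b , (qb , bc) , b≢cut) =
                  inj₂ (b , (bfree , border-inner (swap o) qb) , border-centre (swap o) qb central-c , hits)
            where
            b≢a′ : b ≢ a′
            b≢a′ refl = b≢cut a′c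
            bfree : σ b ≡ free
            -- If `b` were claimed, it would have a partner too, and the two rungs would form the
            -- configuration excluded by `no-rung-pair`.
            bfree = not-cut b≢cut λ bs → no-rung-pair o ra ac ρ qb bc (proj₁ (proj₂ (matched bs))) b≢a′
            hits : ∀ {x y} → Side r x → Side q y → Hits σ b x y
            hits {_} {y} _ (qy , yc) with y ≟ a′ | b ≟ y
            ... | yes refl | _ = inj₂ (inj₁ a′c)
            ... | no _ | yes b≡y = inj₂ (inj₂ (inj₂ b≡y))
            ... | no y≢a′ | no b≢y = ⊥-elim (no-rung-fork o ra ac ρ qb bc qy yc b≢a′ y≢a′ b≢y)

          -- By `no-hub`, `c` cannot have two neighbours in both borders. If neither side is fully
          -- deleted, the only neighbour of `c` on one side is free and meets every route.
          answer-unclaimed : ∀ {σ} → (∀ {x} → Side s x → σ x ≢ short) → (∀ {x} → Side t x → σ x ≢ short) →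
                             Answer σ s t
          answer-unclaimed {σ} ¬s ¬t
            with any? (λ x → Side? s x ×-dec ¬? (cut? (σ x))) | any? (λ x → Side? t x ×-dec ¬? (cut? (σ x)))
          ... | no none | _ = inj₁ λ {a} sa _ →
                  inj₁ (decidable-stable (cut? (σ a)) λ a≢ → none (a , sa , a≢))
          ... | yes _ | no none = inj₁ λ {_} {b} _ sb →
                  inj₂ (decidable-stable (cut? (σ b)) λ b≢ → none (b , sb , b≢))
          ... | yes (a , (sa , ac) , a≢cut) | yes (b , (tb , bc) , b≢cut)
            with any? (λ y → Side? t y ×-dec ¬? (b ≟ y))
          ... | no none = inj₂ (b , (not-cut b≢cut (¬t (tb , bc)) , border-inner back tb) ,
                  border-centre back tb central-c ,
                  λ {_} {y} _ sy → inj₂ (inj₂ (inj₂ (decidable-stable (b ≟ y) λ b≢y → none (y , sy , b≢y)))))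
          ... | yes (y , (ty , yc) , b≢y) = inj₂ (a , (not-cut a≢cut (¬s (sa , ac)) , border-inner forth sa) ,
                  border-centre forth sa central-c ,
                  λ {x} (sx , xc) _ → inj₂ (inj₂ (inj₁ (decidable-stable (a ≟ x) λ a≢x →
                    no-hub sa ac sx xc tb bc ty yc a≢x b≢y))))

          answer : ∀ {σ} → Waiting σ → Answer σ s t
          answer {σ} w with any? (λ x → Side? s x ×-dec short? (σ x)) | any? (λ x → Side? t x ×-dec short? (σ x))
          ... | yes (a , sa , as) | _ = answer-claimed forth w sa as
          ... | no _ | yes (b , sb , bs) = answer-swap {σ} (answer-claimed back w sb bs)
          ... | no ¬s | no ¬t = answer-unclaimed (λ sx e → ¬s (_ , sx , e)) (λ tx e → ¬t (_ , tx , e))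

          no-rung-at-hub : (σ : State n) → ¬ (∃ λ u → Rung c u × σ u ≡ free)
          no-rung-at-hub σ (_ , ρ , _) = rung-centre ρ central-c refl

          -- The centre lies on no rung, so claiming it leaves the pairing intact and gives Cut the
          -- move needed to close all routes through it. After that the pairing strategy suffices.
          hub-taken : ∀ {σ} → Free σ c → Waiting σ → ¬ WinCutToMove (σ [ c ≔ short ])
          hub-taken {σ} fc w@(_ , paired , _) with answer w
          ... | inj₁ d = blocked-passes (paired′ , dead)
            where
            paired′ : Paired (σ [ c ≔ short ])
            paired′ = paired-short σ fc (no-rung-at-hub σ) paired
            dead : Dead (σ [ c ≔ short ])
            dead {c = k} sa ac ce cb tb with refl ← centre-unique k c ce central-c | d (sa , ac) (tb , ~-sym cb)
            ... | inj₁ e = inj₁ (stay-cut σ fc e)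
            ... | inj₂ e = inj₂ (inj₂ (stay-cut σ fc e))
          ... | inj₂ (u , fu , u≢c , hits) = replies fu′ (paired-cut τ u paired′ , dead)
            where
            τ : State n
            τ = σ [ c ≔ short ]
            fu′ : Free τ u
            fu′ = stay-free σ u≢c fu
            paired′ : Paired τ
            paired′ = paired-short σ fc (no-rung-at-hub σ) paired
            dead : Dead (τ [ u ≔ cut ])
            dead {c = k} sa ac ce cb tb with refl ← centre-unique k c ce central-c | hits (sa , ac) (tb , ~-sym cb)
            ... | inj₁ e                  = inj₁ (stay-cut τ fu′ (stay-cut σ fc e))
            ... | inj₂ (inj₁ e)           = inj₂ (inj₂ (stay-cut τ fu′ (stay-cut σ fc e)))
            ... | inj₂ (inj₂ (inj₁ refl)) = inj₁ (set-same τ u cut)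
            ... | inj₂ (inj₂ (inj₂ refl)) = inj₂ (inj₂ (set-same τ u cut))

          waiting-loses : ∀ {σ} → Waiting σ → ¬ WinShortToMove σ
          -- The play cannot be over while `c` is free.
          waiting-loses (cf , _) (done nf _) = nf c (cf , proj₁ (centre-apart central-c))
          waiting-loses {σ} w@(cf , paired , matched) (move v fv win)
            with v ≟ c | any? (λ u → Rung? v u ×-dec free? (σ u))
          ... | yes refl | _ = hub-taken fv w win
          -- The claimed vertex has no free partner, so no reply to it is due; the spare move
          -- deletes `c` and with it all routes through the centre.
          ... | no v≢c | no none = replies fc (paired-cut τ c (paired-short σ fv none paired) , dead) win
            where
            τ : State n
            τ = σ [ v ≔ short ]
            fc : Free τ c
            fc = stay-free σ (≢-sym v≢c) (cf , proj₁ (centre-apart central-c))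
            dead : Dead (τ [ c ≔ cut ])
            dead {c = k} _ _ ce _ _ with refl ← centre-unique k c ce central-c = inj₂ (inj₁ (set-same τ c cut))
          ... | no v≢c | yes (u , ρ , uf) = rung-reply win
            where
            τ : State n
            τ = σ [ v ≔ short ]
            fu : Free τ u
            fu = stay-free σ (≢-sym (~-irrefl (proj₁ ρ))) (uf , rung-inner (Rung-sym ρ))
            c≢u : c ≢ u
            c≢u = ≢-sym (rung-centre (Rung-sym ρ) central-c)
            matched′ : ∀ {x} → (τ [ u ≔ cut ]) x ≡ short → ∃ λ y → Rung x y × (τ [ u ≔ cut ]) y ≡ cut
            matched′ {x} e with x ≟ u | x ≟ v
            matched′ () | yes refl | _
            ... | no _ | yes refl = u , ρ , set-same τ u cut
            ... | no x≢u | no x≢v with matched e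
            ...   | y , ρ′ , yc = y , ρ′ , stay-cut τ fu (stay-cut σ fv yc)
            rung-reply : ¬ WinCutToMove τ
            rung-reply (done nf _) = nf u fu
            rung-reply (move _ f) = waiting-loses
              (trans (set-other τ c≢u) (trans (set-other σ (≢-sym v≢c)) cf) , paired-reply σ ρ paired , matched′)
              (f u fu)

  -- Consequences of minimality.

  Preserves : Fin n → Adj n → Set
  Preserves z a = ∀ p q → p ≢ z → q ≢ z → p ~ q → a p q ≡ true

  deleteEdge-preserves : ∀ u z → Preserves z (deleteEdge (adj G) u z)
  deleteEdge-preserves u z p q p≢z q≢z pq
    rewrite pq | ==-false p≢z | ==-false q≢z | Bool.∧-zeroʳ (p == u) = refl

  module Minimal (s≢t : s ≢ t) (minimal : MinimalWeakLink G s t) where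

    s≁t : adj G s t ≡ false
    s≁t with adj G s t in st
    ... | false = refl
    -- An edge joining the terminals would connect them without any claim, and Short would win even
    -- as second player.
    ... | true  = contradiction
      (Strategy.connected-second (adj G) s t (Game.step Game.start (inj₁ refl) st))
      (proj₂ (proj₁ minimal))

    t≁s : adj G t s ≡ false
    t≁s = trans (Graph.sym G t s) s≁t

    -- If `z` were in a border, deleting its edge to that terminal would not disturb a win that
    -- avoids `z`, contrary to minimality.
    local-win⇒central : ∀ {z} → z ≢ s → z ≢ t →
      (∀ a → Preserves z a → Game.ShortWinsFirst a s t) → Centre z
    local-win⇒central {z} z≢s z≢t wins with kind z
    ... | is-s e     = contradiction e z≢s
    ... | is-t e     = contradiction e z≢t
    ... | central ce = ce
    ... | near-s sz  = contradiction (wins _ (deleteEdge-preserves s z)) (proj₂ minimal s z sz)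
    ... | near-t tz  = contradiction (wins _ (deleteEdge-preserves t z)) (proj₂ minimal t z tz)

    -- A vertex outside the list and the two terminals would be central by `local-win⇒central`, yet
    -- all centre vertices are listed. So Short cannot have a win confined to `xs`.
    local-win-spans : (xs : List (Fin n)) → (∀ {v} → Centre v → v ∈ xs) → 2 + length xs < n →
      ¬ (∀ {z} → z ∉ s ∷ t ∷ xs → ∀ a → Preserves z a → Game.ShortWinsFirst a s t)
    local-win-spans xs centres len wins with ∃-outside (s ∷ t ∷ xs) len
    ... | z , z∉ = ∉-tail (∉-tail z∉) (centres
      (local-win⇒central (≢-sym (∉-head z∉)) (≢-sym (∉-head (∉-tail z∉))) (wins z∉)))

    module _ {z : Fin n} (s≢z : s ≢ z) (t≢z : t ≢ z) {a : Adj n} (pres : Preserves z a) where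

      path₁ : ∀ {x} → x ≢ z → s ~ x → t ~ x → Path₁ a s t x
      path₁ x≢z sx tx τx = Game.step (Game.step Game.start (inj₁ refl) (pres _ _ s≢z x≢z sx))
                             (inj₂ τx) (pres _ _ x≢z t≢z (~-sym tx))

      path₂ : ∀ {x y} → x ≢ z → y ≢ z → Rung x y → Path₂ a s t x y
      path₂ x≢z y≢z (xy , inj₁ (sx , ty)) τx τy =
        Game.step (Game.step (Game.step Game.start (inj₁ refl) (pres _ _ s≢z x≢z sx))
          (inj₂ τx) (pres _ _ x≢z y≢z xy)) (inj₂ τy) (pres _ _ y≢z t≢z (~-sym ty))
      path₂ x≢z y≢z (xy , inj₂ (tx , sy)) τx τy =
        Game.step (Game.step (Game.step Game.start (inj₁ refl) (pres _ _ s≢z y≢z sy))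
          (inj₂ τy) (pres _ _ y≢z x≢z (~-sym xy))) (inj₂ τx) (pres _ _ x≢z t≢z (~-sym tx))

      path₃-forth : ∀ {x c y} → x ≢ z → c ≢ z → y ≢ z → s ~ x → x ~ c → t ~ y → y ~ c → Path₃ a s t x c y
      path₃-forth x≢z c≢z y≢z sx xc ty yc τx τc τy =
        Game.step (Game.step (Game.step (Game.step Game.start (inj₁ refl) (pres _ _ s≢z x≢z sx))
          (inj₂ τx) (pres _ _ x≢z c≢z xc)) (inj₂ τc) (pres _ _ c≢z y≢z (~-sym yc)))
          (inj₂ τy) (pres _ _ y≢z t≢z (~-sym ty))

      path₃ : ∀ {r q x c y} → Opposite r q → x ≢ z → c ≢ z → y ≢ z →
              r ~ x → x ~ c → q ~ y → y ~ c → Path₃ a s t x c y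
      path₃ forth x≢z c≢z y≢z sx xc ty yc = path₃-forth x≢z c≢z y≢z sx xc ty yc
      path₃ back  x≢z c≢z y≢z tx xc sy yc = λ τx τc τy →
        path₃-forth y≢z c≢z x≢z sy yc tx xc τy τc τx

    common-inner : ∀ {v} → s ~ v → t ~ v → Inner (adj G) s t v
    common-inner sv tv = ≢-sym (~-irrefl sv) , ≢-sym (~-irrefl tv)

    common-spans : ∀ {v} → s ~ v → t ~ v → (cs : List (Fin n)) → (∀ {u} → Centre u → u ∈ cs) →
                   ¬ (3 + length cs < n)
    common-spans {v} sv tv cs centres len =
      local-win-spans (v ∷ cs) (there ∘ centres) len λ z∉ a pres →
        Strategy.singleton-wins a s t (common-inner sv tv)
          (path₁ (∉-head z∉) (∉-head (∉-tail z∉)) pres (∉-head (∉-tail (∉-tail z∉))) sv tv)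

    -- Excluding small centres when the borders are disjoint.

    module Spread (disjoint : ∀ {v} → s ~ v → t ~ v → ⊥) where
      open Separated s≁t disjoint

      -- Two rungs at `x` are two threats, so Short wins on `x`, `y`, `w`. These and the terminals
      -- account for the 5.
      cherry-spans : ∀ {x y w} → Rung x y → Rung x w → y ≢ w →
                     (cs : List (Fin n)) → (∀ {u} → Centre u → u ∈ cs) → ¬ (5 + length cs < n)
      cherry-spans {x} {y} {w} ρ ρ′ y≢w cs centres len =
        local-win-spans (x ∷ y ∷ w ∷ cs) (there ∘ there ∘ there ∘ centres) len λ z∉s a pres →
          let z∉t = ∉-tail z∉s ; z∉x = ∉-tail z∉t ; z∉y = ∉-tail z∉x ; z∉w = ∉-tail z∉y
              path : ∀ {u} → u ≢ _ → Rung x u → Path₂ a s t x u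
              path = path₂ (∉-head z∉s) (∉-head z∉t) pres (∉-head z∉x)
          in Strategy.cherry-wins a s t (rung-inner ρ) (rung-inner (Rung-sym ρ)) (rung-inner (Rung-sym ρ′))
               (~-irrefl (proj₁ ρ)) (~-irrefl (proj₁ ρ′)) y≢w
               (path (∉-head z∉y) ρ) (path (∉-head z∉w) ρ′)

      matching : (cs : List (Fin n)) → (∀ {u} → Centre u → u ∈ cs) → 5 + length cs < n →
                 ∀ {x y z} → Rung x y → Rung x z → y ≡ z
      matching cs centres len {y = y} {z} ρ ρ′ =
        decidable-stable (y ≟ z) λ y≢z → cherry-spans ρ ρ′ y≢z cs centres len

      initially-paired : ∀ {x y} → Rung x y → free ≡ cut ⊎ free ≡ cut ⊎ (free ≡ free × free ≡ free)
      initially-paired _ = inj₂ (inj₂ (refl , refl))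

      -- The rungs form a matching and no route uses the centre, so the initial position is already
      -- blocked and Short loses.
      centreless-small : (∀ {v} → ¬ Centre v) → ¬ (5 < n)
      centreless-small none len =
        Cut.blocked-loses (matching [] (⊥-elim ∘ none) len) (λ _ _ ce _ → ⊥-elim (none ce)) s≢t
          (initially-paired , λ _ _ ce _ _ → ⊥-elim (none ce)) (proj₁ (proj₁ minimal))

      module OneCentre (c : Fin n) (central-c : Centre c) (only : ∀ {v} → Centre v → v ≡ c) (len : 7 < n) where

        inner-c : Inner (adj G) s t c
        inner-c = proj₁ (centre-apart central-c)

        only-∈ : ∀ {xs v} → Centre v → v ∈ c ∷ xs
        only-∈ ce = here (only ce)

        matched : ∀ {x y z} → Rung x y → Rung x z → y ≡ z
        matched = matching (c ∷ []) only-∈ (≤-trans (n≤1+n 7) len)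

        -- Otherwise `hub-wins` applies to `c` and its four neighbours, which with the terminals
        -- make seven vertices, fewer than `n`.
        no-hub : ∀ {x y z w} → s ~ x → x ~ c → s ~ y → y ~ c → t ~ z → z ~ c → t ~ w → w ~ c →
                 x ≢ y → z ≢ w → ⊥
        no-hub {x} {y} {z} {w} sx xc sy yc tz zc tw wc x≢y z≢w =
          local-win-spans (c ∷ x ∷ y ∷ z ∷ w ∷ []) only-∈ len λ v∉s a pres →
            let v∉t = ∉-tail v∉s ; v∉c = ∉-tail v∉t ; v∉x = ∉-tail v∉c
                v∉y = ∉-tail v∉x ; v∉z = ∉-tail v∉y ; v∉w = ∉-tail v∉z
                path : ∀ {p q} → p ≢ _ → q ≢ _ → s ~ p → p ~ c → t ~ q → q ~ c → Path₃ a s t p c q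
                path p≢ q≢ = path₃ (∉-head v∉s) (∉-head v∉t) pres forth p≢ (∉-head v∉c) q≢
            in Strategy.hub-wins a s t inner-c
                 (border-inner forth sx) (border-inner forth sy) (border-inner back tz) (border-inner back tw)
                 (c≢ forth sx) (c≢ forth sy) (c≢ back tz) (c≢ back tw) x≢y z≢w
                 (across forth sx tz) (across forth sx tw) (across forth sy tz) (across forth sy tw)
                 (path (∉-head v∉x) (∉-head v∉z) sx xc tz zc) (path (∉-head v∉x) (∉-head v∉w) sx xc tw wc)
                 (path (∉-head v∉y) (∉-head v∉z) sy yc tz zc) (path (∉-head v∉y) (∉-head v∉w) sy yc tw wc)
          where
          c≢ : ∀ {r q u} → Opposite r q → r ~ u → c ≢ u
          c≢ o ru = ≢-sym (border-centre o ru central-c)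

        -- Claiming `a` forces the deletion of `a′`; then `c` threatens to connect through `b` and
        -- through `b′`.
        no-rung-fork : ∀ {r q a a′ b b′} → Opposite r q → r ~ a → a ~ c → Rung a a′ →
                       q ~ b → b ~ c → q ~ b′ → b′ ~ c → b ≢ a′ → b′ ≢ a′ → b ≢ b′ → ⊥
        no-rung-fork {a = x} {x′} {y} {y′} o rx xc ρ qy yc qy′ y′c y≢x′ y′≢x′ y≢y′ =
          local-win-spans (c ∷ x ∷ x′ ∷ y ∷ y′ ∷ []) only-∈ len λ v∉s a pres →
            let v∉t = ∉-tail v∉s ; v∉c = ∉-tail v∉t ; v∉x = ∉-tail v∉c
                v∉x′ = ∉-tail v∉x ; v∉y = ∉-tail v∉x′ ; v∉y′ = ∉-tail v∉y
                s≢ = ∉-head v∉s ; t≢ = ∉-head v∉t ; c≢ = ∉-head v∉c ; x≢ = ∉-head v∉x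
            in Strategy.forced-fork-wins a s t
                 (rung-inner ρ) (rung-inner (Rung-sym ρ)) inner-c
                 (border-inner (swap o) qy) (border-inner (swap o) qy′)
                 (~-irrefl (proj₁ ρ)) (rung-centre ρ central-c) (across o rx qy) (across o rx qy′)
                 (rung-centre (Rung-sym ρ) central-c) (≢-sym y≢x′) (≢-sym y′≢x′)
                 (≢-sym (border-centre (swap o) qy central-c)) (≢-sym (border-centre (swap o) qy′ central-c))
                 y≢y′ (path₂ s≢ t≢ pres x≢ (∉-head v∉x′) ρ)
                 (λ e → path₃ s≢ t≢ pres o x≢ c≢ (∉-head v∉y) rx xc qy yc
                          (retain e (set-same initial x short)))
                 (λ e → path₃ s≢ t≢ pres o x≢ c≢ (∉-head v∉y′) rx xc qy′ y′c
                          (retain e (set-same initial x short)))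

        -- Claiming `a` forces the deletion of `a′`; then `b` threatens both `c`, which joins it to
        -- `a`, and `b′`, which completes its own rung.
        no-rung-pair : ∀ {r q a a′ b b′} → Opposite r q → r ~ a → a ~ c → Rung a a′ →
                       q ~ b → b ~ c → Rung b b′ → b ≢ a′ → ⊥
        no-rung-pair {a = x} {x′} {y} {y′} o rx xc ρ qy yc ρ′ y≢x′ =
          local-win-spans (c ∷ x ∷ x′ ∷ y ∷ y′ ∷ []) only-∈ len λ v∉s a pres →
            let v∉t = ∉-tail v∉s ; v∉c = ∉-tail v∉t ; v∉x = ∉-tail v∉c
                v∉x′ = ∉-tail v∉x ; v∉y = ∉-tail v∉x′ ; v∉y′ = ∉-tail v∉y
                s≢ = ∉-head v∉s ; t≢ = ∉-head v∉t ; c≢ = ∉-head v∉c ; x≢ = ∉-head v∉x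
            in Strategy.forced-fork-wins a s t
                 (rung-inner ρ) (rung-inner (Rung-sym ρ)) (rung-inner ρ′) inner-c (rung-inner (Rung-sym ρ′))
                 (~-irrefl (proj₁ ρ)) (across o rx qy) (rung-centre ρ central-c)
                 -- If `a` were `b′`, it would have the partners `b` and `a′`, which the matching
                 -- identifies.
                 (λ { refl → y≢x′ (matched (Rung-sym ρ′) ρ) })
                 (≢-sym y≢x′) (rung-centre (Rung-sym ρ) central-c)
                 (≢-sym (across o (rung-across (swap o) qy ρ′) (rung-across o rx ρ)))
                 (rung-centre ρ′ central-c) (~-irrefl (proj₁ ρ′))
                 (≢-sym (rung-centre (Rung-sym ρ′) central-c))
                 (path₂ s≢ t≢ pres x≢ (∉-head v∉x′) ρ)
                 (λ e τy τc → path₃ s≢ t≢ pres o x≢ c≢ (∉-head v∉y) rx xc qy yc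
                                (retain e (set-same initial x short)) τc τy)
                 (λ _ → path₂ s≢ t≢ pres (∉-head v∉y) (∉-head v∉y′) ρ′)

        contradictory : ⊥
        contradictory =
          Cut.Hub.waiting-loses matched (λ _ _ ce ce′ → trans (only ce) (≡-sym (only ce′))) s≢t
            c central-c no-hub no-rung-fork no-rung-pair
            (refl , initially-paired , λ ()) (proj₁ (proj₁ minimal))

      -- The borders, the centre and the pair of terminals are pairwise disjoint.
      border-count : degree G s + degree G t + centreSize G s t + 2 ≤ n
      border-count = subst (_≤ n) total (count-≤ _)
        where
        terminal near : Fin n → Bool
        terminal v = (v == s) ∨ (v == t)
        near v = adj G s v ∨ adj G t v

        near-fresh : ∀ i → adj G s i ≡ true → adj G t i ≡ false
        near-fresh i si with adj G t i in ti
        ... | true  = ⊥-elim (disjoint si ti)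
        ... | false = refl

        centre-fresh : ∀ i → near i ≡ true → isCentre G s t i ≡ false
        centre-fresh i e with isCentre G s t i in ci
        ... | false = refl
        ... | true with ∨-true (adj G s i) e
        ...   | inj₁ si = contradiction refl (border-centre forth si (centre ci))
        ...   | inj₂ ti = contradiction refl (border-centre back ti (centre ci))

        inner-nonterminal : ∀ i → Inner (adj G) s t i → terminal i ≡ false
        inner-nonterminal i (i≢s , i≢t) = ∨-false (==-false i≢s) (==-false i≢t)

        terminal-fresh : ∀ i → near i ∨ isCentre G s t i ≡ true → terminal i ≡ false
        terminal-fresh i e with ∨-true (near i) e
        ... | inj₂ ci = inner-nonterminal i (proj₁ (centre-apart (centre {i} ci)))
        ... | inj₁ ni with ∨-true (adj G s i) ni
        ...   | inj₁ si = inner-nonterminal i (border-inner forth si)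
        ...   | inj₂ ti = inner-nonterminal i (border-inner back ti)

        total : count (λ v → (near v ∨ isCentre G s t v) ∨ terminal v)
                ≡ degree G s + degree G t + centreSize G s t + 2
        total = trans (count-∨ _ _ terminal-fresh) (cong₂ _+_
                  (trans (count-∨ _ _ centre-fresh)
                         (cong (_+ centreSize G s t) (count-∨ _ _ near-fresh)))
                  (trans (count-insert (_== t) s (==-false s≢t)) (cong suc (count-== t))))

    -- Lower bounds on the size of the centre.

    common? : Dec (∃ λ v → s ~ v × t ~ v)
    common? = any? (λ v → s ~? v ×-dec t ~? v)

    centreless : (∀ {v} → ¬ Centre v) → ¬ (5 < n)
    centreless none len with common?
    ... | yes (v , sv , tv) = common-spans sv tv [] (⊥-elim ∘ none) (≤-trans (m≤n+m 4 2) len)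
    ... | no ¬common = Spread.centreless-small (λ sv tv → ¬common (_ , sv , tv)) none len

    one-centre : ∀ {c} → Centre c → (∀ {v} → Centre v → v ≡ c) → ¬ (7 < n)
    one-centre {c} central-c only len with common?
    ... | yes (v , sv , tv) = common-spans sv tv (c ∷ []) (here ∘ only) (≤-trans (m≤n+m 5 3) len)
    ... | no ¬common = Spread.OneCentre.contradictory (λ sv tv → ¬common (_ , sv , tv)) c central-c only len

    centre-exists : 5 < n → 1 ≤ centreSize G s t
    centre-exists len with any? Centre?
    ... | yes (c , ce) = count-pos (isCentre G s t) {c} (isCentre-true ce)
    ... | no none = contradiction len (centreless (none ∘ (_ ,_)))

    two-centres : 7 < n → 2 ≤ centreSize G s t
    two-centres len with any? Centre? | centreSize G s t <? 2
    ... | _ | no p≮2 = ≮⇒≥ p≮2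
    ... | no none | _ = contradiction (≤-trans (m≤n+m 6 2) len) (centreless (none ∘ (_ ,_)))
    ... | yes (c , central-c) | yes p<2 = contradiction len (one-centre central-c λ ce →
            ≡-sym (count≤1⇒unique c (isCentre G s t) (s≤s⁻¹ p<2)
              (isCentre-true central-c) (isCentre-true ce)))

    -- The degree bound.

    degree-common : ∀ {r v} → (∀ {z} → r ~ z → z ≡ v) → degree G r ≤ 1
    degree-common {r} {v} only = subst (degree G r ≤_) (count-== v) (count-mono (adj G r) (_== v)
      λ i ri → trans (cong (_== v) (only ri)) (==-refl v))

    -- Short wins by claiming `v` alone, so by `local-win⇒central` every other non-terminal is
    -- central and hence adjacent to neither terminal.
    common-degrees : ∀ {v} → s ~ v → t ~ v → degree G s ≤ 1 × degree G t ≤ 1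
    common-degrees {v} sv tv = degree-common (λ {z} → near z forth) , degree-common (λ {z} → near z back)
      where
      near : ∀ {r q} z → Opposite r q → r ~ z → z ≡ v
      near {r} z o rz with z ≟ v
      ... | yes z≡v = z≡v
      ... | no  z≢v = contradiction rz (false≢true (not-near o))
        where
        inner-z : ∀ {r q} → Opposite r q → r ~ z → Inner (adj G) s t z
        inner-z forth sz = ≢-sym (~-irrefl sz) , λ { refl → false≢true s≁t sz }
        inner-z back  tz = (λ { refl → false≢true t≁s tz }) , ≢-sym (~-irrefl tz)
        z≢s = proj₁ (inner-z o rz)
        z≢t = proj₂ (inner-z o rz)
        central-z : Centre z
        central-z = local-win⇒central z≢s z≢t λ a pres →
          Strategy.singleton-wins a s t (common-inner sv tv)
            (path₁ (≢-sym z≢s) (≢-sym z≢t) pres (≢-sym z≢v) sv tv)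
        not-near : ∀ {r q} → Opposite r q → adj G r z ≡ false
        not-near forth = proj₁ (proj₂ (centre-apart central-z))
        not-near back  = proj₂ (proj₂ (centre-apart central-z))

    common-weight : ∀ {v} → s ~ v → t ~ v → 3 ≤ n
    common-weight {v} sv tv = subst (_≤ n) total (count-≤ _)
      where
      total : count (λ i → (i == s) ∨ ((i == t) ∨ (i == v))) ≡ 3
      total = trans (count-insert _ s (∨-false (==-false s≢t) (==-false (~-irrefl sv))))
                (cong suc (trans (count-insert _ t (==-false (~-irrefl tv))) (cong suc (count-== v))))

-- The first two bounds, read backwards, give weight at most 3 for `p` = 0 and at most 5 for `p` =
-- 1; from `p` = 2 on, 7 is enough.
weight-bound : ∀ p w → (3 < w → 1 ≤ p) → (5 < w → 2 ≤ p) → w ≤ 7 → w ≤ 2 * p + 3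
weight-bound zero w h _ _ = ≮⇒≥ λ 3<w → ≤⇒≯ z≤n (h 3<w)
weight-bound (suc zero) w _ h _ = ≮⇒≥ λ 5<w → ≤⇒≯ (s≤s z≤n) (h 5<w)
weight-bound (suc (suc p)) w _ _ w≤7 =
  ≤-trans w≤7 (+-monoˡ-≤ 3 (*-monoʳ-≤ 2 {2} {suc (suc p)} (s≤s (s≤s z≤n))))

-- Doubling the first hypothesis and using the second once gives 2d + 2p ≤ 2w ≤ w + 2p + 3; then 2p
-- cancels.
degree-bound : ∀ d p w → d + p ≤ w → w ≤ 2 * p + 3 → 2 * d ≤ w + 3
degree-bound d p w dp≤w w≤ = +-cancelʳ-≤ (2 * p) (2 * d) (w + 3) (begin
  2 * d + 2 * p     ≡⟨ *-distribˡ-+ 2 d p ⟨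
  2 * (d + p)       ≤⟨ *-monoʳ-≤ 2 dp≤w ⟩
  w + (w + 0)       ≡⟨ cong (w +_) (+-identityʳ w) ⟩
  w + w             ≤⟨ +-monoʳ-≤ w w≤ ⟩
  w + (2 * p + 3)   ≡⟨ cong (w +_) (+-comm (2 * p) 3) ⟩
  w + (3 + 2 * p)   ≡⟨ +-assoc w 3 (2 * p) ⟨
  w + 3 + 2 * p     ∎)
  where open ≤-Reasoning

theorem1 : (n : ℕ) (G : Graph n) (s t : Fin n) → s ≢ t →
    MinimalWeakLink G s t →
    (3 < n ∸ 2 → 1 ≤ centreSize G s t) ×
    (5 < n ∸ 2 → 2 ≤ centreSize G s t) ×
    (n ∸ 2 ≤ 7 → 2 * (degree G s + degree G t) ≤ (n ∸ 2) + 3)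
-- Distinct terminals need two vertices, so in the remaining case the truncated subtraction `n ∸ 2`
-- is exactly the weight.
theorem1 (suc zero) G Fin.zero Fin.zero s≢t _ = contradiction refl s≢t
theorem1 (suc (suc w)) G s t s≢t minimal = one , two , bound
  where
  open Link G s t
  open Minimal s≢t minimal

  one : 3 < w → 1 ≤ centreSize G s t
  one 3<w = centre-exists (s≤s (s≤s 3<w))

  two : 5 < w → 2 ≤ centreSize G s t
  two 5<w = two-centres (s≤s (s≤s 5<w))

  total : ℕ
  total = degree G s + degree G t + centreSize G s t

  bound : w ≤ 7 → 2 * (degree G s + degree G t) ≤ w + 3
  bound w≤7 with common?
  ... | yes (v , sv , tv) with ds≤1 , dt≤1 ← common-degrees sv tv =
    -- Both degrees are at most 1, and the common neighbour gives `w` ≥ 1, so the doubled sum is at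
    -- most 4 ≤ w + 3.
    ≤-trans (*-monoʳ-≤ 2 (+-mono-≤ ds≤1 dt≤1)) (+-monoˡ-≤ 3 (s≤s⁻¹ (s≤s⁻¹ (common-weight sv tv))))
  ... | no ¬common = degree-bound (degree G s + degree G t) (centreSize G s t) w
    (+-cancelʳ-≤ 2 total w (subst (total + 2 ≤_) (+-comm 2 w)
      (Spread.border-count (λ sv tv → ¬common (_ , sv , tv)))))
    (weight-bound _ w one two w≤7)
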